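{- Let $\mathcal D$ be a non-trivial $G$-pairwise transitive $2$-design, where $G\le\mathrm{Aut}(\mathcal D)$. If $G$ has rank $2$ on blocks, then $\mathcal D$ is a symmetric design. If $G$ has rank $3$ on blocks, then $\mathcal D$ is a quasisymmetric design containing disjoint block pairs.
   Context: A design $\mathcal D=(\mathcal P,\mathcal B,\mathcal I)$ consists of finite sets $\mathcal P$ (points), $\mathcal B$ (blocks) and an incidence relation $\mathcal I\subseteq\mathcal P\times\mathcal B$. It is a $2$-$(v,k,\lambda)$ design (or $2$-design) if $|\mathcal P|=v$, each block is incident with exactly $k$ points, and each pair of distinct points is incident with exactly $\lambda$ common blocks. It is non-trivial if $2<k<v$; symmetric if $|\mathcal B|=v$; quasisymmetric if the number of points common to two distinct blocks takes exactly two values. An automorphism is a permutation of $\mathcal P\cup\mathcal B$ leaving $\mathcal P$ and $\mathcal B$ invariant setwise and preserving incidence; $\mathrm{Aut}(\mathcal D)$ is the group of all automorphisms. Two blocks are intersecting if some point is incident with both, and disjoint (non-intersecting) otherwise. For $G\le\mathrm{Aut}(\mathcal D)$, the $2$-design $\mathcal D$ is $G$-pairwise transitive if $G$ is transitive on each of the following five (possibly empty) sets of ordered pairs: pairs of distinct points, incident point-block pairs, non-incident point-block pairs, pairs of distinct intersecting blocks, pairs of non-intersecting blocks. A transitive permutation group has rank $n$ if a point stabiliser has exactly $n$ orbits. -}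

module Defs where

open import Algebra.Bundles using (Group)
open import Data.Fin using (Fin)
import Data.Fin.Permutation as Perm
open Perm using (Permutation′; _⟨$⟩ʳ_)
open import Data.Nat using (ℕ; _<_)
open import Data.Product using (∃; ∃₂; _×_; _,_; proj₁; proj₂)
open import Data.Sum using (_⊎_)
open import Data.Vec using (allFin; count)
open import Function.Bundles using (Bijection; _⇔_; mk⇔; Equivalence)
open import Level using (Level; 0ℓ; _⊔_) renaming (suc to lsuc)
open import Relation.Binary using (REL; Decidable; Setoid)
open import Relation.Binary.PropositionalEquality using (_≡_; _≢_; refl; sym; trans; cong; cong₂; subst₂; setoid)
open import Relation.Nullary using (¬_)
open import Relation.Nullary.Decidable using (_×-dec_)
open import Relation.Unary using (Pred)

private
  variable
    c ℓ p s x y : Level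

record Subgroup (G : Group c ℓ) (p : Level) : Set (c ⊔ ℓ ⊔ lsuc p) where
  open Group G using (Carrier; _≈_; _∙_; ε; _⁻¹)
  field
    Member    : Pred Carrier p
    resp      : ∀ {g h} → g ≈ h → Member g → Member h
    ε-closed  : Member ε
    ∙-closed  : ∀ {g h} → Member g → Member h → Member (g ∙ h)
    ⁻¹-closed : ∀ {g} → Member g → Member (g ⁻¹)

record Action (G : Group c ℓ) (X : Set x) : Set (c ⊔ ℓ ⊔ x) where
  open Group G using (Carrier; _≈_; _∙_; ε; _⁻¹; inverseˡ)
  infixr 6 _▷_
  field
    _▷_    : Carrier → X → X
    ▷-cong : ∀ {g h} → g ≈ h → ∀ a → g ▷ a ≡ h ▷ a
    ε-▷    : ∀ a → ε ▷ a ≡ a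
    ∙-▷    : ∀ g h a → (g ∙ h) ▷ a ≡ g ▷ h ▷ a

  ⁻¹-▷ : ∀ {g a b} → g ▷ a ≡ b → g ⁻¹ ▷ b ≡ a
  ⁻¹-▷ {g} {a} refl =
    trans (sym (∙-▷ (g ⁻¹) g a)) (trans (▷-cong (inverseˡ g) a) (ε-▷ a))

  ∙-▷-trans : ∀ {g h a b d} → g ▷ a ≡ b → h ▷ b ≡ d → (h ∙ g) ▷ a ≡ d
  ∙-▷-trans {g} {h} {a} refl refl = ∙-▷ h g a

pairAction : {G : Group c ℓ} {X : Set x} {Y : Set y} →
             Action G X → Action G Y → Action G (X × Y)
pairAction α β = record
  { _▷_    = λ { g (a , b) → (g A.▷ a) , (g B.▷ b) }
  ; ▷-cong = λ { g≈h (a , b) → cong₂ _,_ (A.▷-cong g≈h a) (B.▷-cong g≈h b) }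
  ; ε-▷    = λ { (a , b) → cong₂ _,_ (A.ε-▷ a) (B.ε-▷ b) }
  ; ∙-▷    = λ { g h (a , b) → cong₂ _,_ (A.∙-▷ g h a) (B.∙-▷ g h b) }
  }
  where
  module A = Action α
  module B = Action β

module _ {G : Group c ℓ} (H : Subgroup G p) {X : Set x} (α : Action G X) where
  open Group G using (Carrier; ε; _∙_; _⁻¹)
  open Subgroup H
  open Action α

  SameOrbit : X → X → Set (c ⊔ p ⊔ x)
  SameOrbit a b = ∃ λ g → Member g × g ▷ a ≡ b

  -- The set of H-orbits: elements of X, identified when in the same orbit.
  Orbits : Setoid x (c ⊔ p ⊔ x)
  Orbits = record
    { Carrier       = X
    ; _≈_           = SameOrbit
    ; isEquivalence = record
      { refl  = λ {a} → ε , ε-closed , ε-▷ a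
      ; sym   = λ { (g , g∈H , eq) → g ⁻¹ , ⁻¹-closed g∈H , ⁻¹-▷ eq }
      ; trans = λ { (g , g∈H , eq) (h , h∈H , eq′) →
                    h ∙ g , ∙-closed h∈H g∈H , ∙-▷-trans eq eq′ }
      }
    }

  Stabiliser : X → Subgroup G (p ⊔ x)
  Stabiliser a = record
    { Member    = λ g → Member g × g ▷ a ≡ a
    ; resp      = λ { g≈h (g∈H , eq) →
                      resp g≈h g∈H , trans (sym (▷-cong g≈h a)) eq }
    ; ε-closed  = ε-closed , ε-▷ a
    ; ∙-closed  = λ { (g∈H , eq) (h∈H , eq′) →
                      ∙-closed g∈H h∈H , ∙-▷-trans eq′ eq }
    ; ⁻¹-closed = λ { (g∈H , eq) → ⁻¹-closed g∈H , ⁻¹-▷ eq }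
    }

  TransitiveOn : Pred X s → Set (c ⊔ p ⊔ x ⊔ s)
  TransitiveOn S = ∀ a b → S a → S b → SameOrbit a b

  Transitive : Set (c ⊔ p ⊔ x)
  Transitive = ∀ a b → SameOrbit a b

HasOrbits : {G : Group c ℓ} (H : Subgroup G p) {X : Set x} (α : Action G X) →
            ℕ → Set (c ⊔ p ⊔ x)
HasOrbits H α n = Bijection (setoid (Fin n)) (Orbits H α)

-- By transitivity it does not matter which point is stabilised.  The
-- existential also rules out actions on the empty set, which have no rank.
HasRank : {G : Group c ℓ} (H : Subgroup G p) {X : Set x} (α : Action G X) →
          ℕ → Set (c ⊔ p ⊔ x)
HasRank H α n = Transitive H α × ∃ λ a → HasOrbits (Stabiliser H α a) α n

-- Blocks are not sets of points: distinct blocks may be incident with the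
-- same points.
record Design (v b : ℕ) : Set₁ where
  infix 4 _I_ _I?_
  field
    _I_  : REL (Fin v) (Fin b) 0ℓ
    _I?_ : Decidable _I_

module _ {v b : ℕ} (D : Design v b) where
  open Design D

  blockSize : Fin b → ℕ
  blockSize B = count (_I? B) (allFin v)

  commonBlocks : Fin v → Fin v → ℕ
  commonBlocks p q = count (λ B → (p I? B) ×-dec (q I? B)) (allFin b)

  commonPoints : Fin b → Fin b → ℕ
  commonPoints B C = count (λ p → (p I? B) ×-dec (p I? C)) (allFin v)

  record Is2Design (k lam : ℕ) : Set where
    field
      block-size : ∀ B → blockSize B ≡ k
      balanced   : ∀ {p q} → p ≢ q → commonBlocks p q ≡ lam

  Intersecting : Fin b → Fin b → Set
  Intersecting B C = ∃ λ p → p I B × p I C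

  Disjoint : Fin b → Fin b → Set
  Disjoint B C = ¬ Intersecting B C

  Symmetric : Set
  Symmetric = b ≡ v

  Quasisymmetric : Set
  Quasisymmetric = ∃₂ λ m n → m ≢ n
    × (∀ {B C} → B ≢ C → commonPoints B C ≡ m ⊎ commonPoints B C ≡ n)
    × (∃₂ λ B C → B ≢ C × commonPoints B C ≡ m)
    × (∃₂ λ B C → B ≢ C × commonPoints B C ≡ n)

  -- A permutation of the disjoint union of points and blocks leaving both
  -- parts invariant is given by its restrictions to the two parts.
  record Automorphism : Set where
    field
      onPoints  : Permutation′ v
      onBlocks  : Permutation′ b
      preserves : ∀ p B → p I B ⇔ (onPoints ⟨$⟩ʳ p) I (onBlocks ⟨$⟩ʳ B)

  open Automorphism

  -- The product f ∙ g is "first g, then f".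
  Aut : Group 0ℓ 0ℓ
  Aut = record
    { Carrier = Automorphism
    ; _≈_     = λ f g → onPoints f Perm.≈ onPoints g × onBlocks f Perm.≈ onBlocks g
    ; _∙_     = λ f g → record
      { onPoints  = onPoints g Perm.∘ₚ onPoints f
      ; onBlocks  = onBlocks g Perm.∘ₚ onBlocks f
      ; preserves = λ p B →
          let module F = Equivalence (preserves f (onPoints g ⟨$⟩ʳ p) (onBlocks g ⟨$⟩ʳ B))
              module G = Equivalence (preserves g p B)
          in mk⇔ (λ i → F.to (G.to i)) (λ i → G.from (F.from i))
      }
    ; ε       = record
      { onPoints  = Perm.id
      ; onBlocks  = Perm.id
      ; preserves = λ _ _ → mk⇔ (λ i → i) (λ i → i)
      }
    ; _⁻¹     = λ f → record
      { onPoints  = Perm.flip (onPoints f)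
      ; onBlocks  = Perm.flip (onBlocks f)
      ; preserves = λ p B →
          let module F = Equivalence (preserves f (onPoints f Perm.⟨$⟩ˡ p) (onBlocks f Perm.⟨$⟩ˡ B))
              eqP = Perm.inverseʳ (onPoints f) {p}
              eqB = Perm.inverseʳ (onBlocks f) {B}
          in mk⇔ (λ i → F.from (subst₂ _I_ (sym eqP) (sym eqB) i))
                 (λ i → subst₂ _I_ eqP eqB (F.to i))
      }
    ; isGroup = record
      { isMonoid = record
        { isSemigroup = record
          { isMagma = record
            { isEquivalence = record
              { refl  = (λ _ → refl) , (λ _ → refl)
              ; sym   = λ { (e , e′) → (λ i → sym (e i)) , (λ i → sym (e′ i)) }
              ; trans = λ { (e , e′) (d , d′) →
                  (λ i → trans (e i) (d i)) , (λ i → trans (e′ i) (d′ i)) }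
              }
            ; ∙-cong = λ { {f} {f′} {g} {g′} (e , e′) (d , d′) →
                (λ i → trans (cong (onPoints f ⟨$⟩ʳ_) (d i)) (e (onPoints g′ ⟨$⟩ʳ i)))
              , (λ i → trans (cong (onBlocks f ⟨$⟩ʳ_) (d′ i)) (e′ (onBlocks g′ ⟨$⟩ʳ i))) }
            }
          ; assoc = λ _ _ _ → (λ _ → refl) , (λ _ → refl)
          }
        ; identity = (λ _ → (λ _ → refl) , (λ _ → refl))
                   , (λ _ → (λ _ → refl) , (λ _ → refl))
        }
      ; inverse = (λ f → (λ _ → Perm.inverseˡ (onPoints f)) , (λ _ → Perm.inverseˡ (onBlocks f)))
                , (λ f → (λ _ → Perm.inverseʳ (onPoints f)) , (λ _ → Perm.inverseʳ (onBlocks f)))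
      ; ⁻¹-cong = λ { {f} {g} (e , e′) →
            flip-cong (onPoints f) (onPoints g) e
          , flip-cong (onBlocks f) (onBlocks g) e′ }
      }
    }
    where
    flip-cong : ∀ {n} (π ρ : Permutation′ n) →
                π Perm.≈ ρ → Perm.flip π Perm.≈ Perm.flip ρ
    flip-cong π ρ e i =
      trans (sym (Perm.inverseˡ ρ))
            (cong (ρ Perm.⟨$⟩ˡ_)
                  (trans (sym (e (π Perm.⟨$⟩ˡ i))) (Perm.inverseʳ π)))

  pointAction : Action Aut (Fin v)
  pointAction = record
    { _▷_    = λ g p → onPoints g ⟨$⟩ʳ p
    ; ▷-cong = proj₁
    ; ε-▷    = λ _ → refl
    ; ∙-▷    = λ _ _ _ → refl
    }

  blockAction : Action Aut (Fin b)
  blockAction = record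
    { _▷_    = λ g B → onBlocks g ⟨$⟩ʳ B
    ; ▷-cong = proj₂
    ; ε-▷    = λ _ → refl
    ; ∙-▷    = λ _ _ _ → refl
    }

  record PairwiseTransitive {p} (G : Subgroup Aut p) : Set p where
    field
      distinct-points     : TransitiveOn G (pairAction pointAction pointAction)
                              λ { (p , q) → p ≢ q }
      incident            : TransitiveOn G (pairAction pointAction blockAction)
                              λ { (p , B) → p I B }
      non-incident        : TransitiveOn G (pairAction pointAction blockAction)
                              λ { (p , B) → ¬ (p I B) }
      intersecting-blocks : TransitiveOn G (pairAction blockAction blockAction)
                              λ { (B , C) → B ≢ C × Intersecting B C }
      disjoint-blocks     : TransitiveOn G (pairAction blockAction blockAction)
                              λ { (B , C) → Disjoint B C }

NonTrivial : (v k : ℕ) → Set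
NonTrivial v k = 2 < k × k < v

{-# OPTIONS --safe #-}

-- Rank 2.  Any two distinct blocks meet in the same number m of points.  Let
-- r be the replication number and count the pairs (q , C) with q I B, p I C
-- and q I C in two ways: λk = mr if p is not incident with B, and
-- r + (k − 1)λ = k + (r − 1)m if it is.  So {r , m} and {k , λ} have the same
-- sum and the same product, whence r = k or r = λ.  The latter is impossible
-- since r(k − 1) = λ(v − 1) with k < v and r > 0, and r = k gives b = v by bk = vr.
--
-- Rank 3.  Of the three orbits of the stabiliser of a block A, one is {A}, and
-- pairwise transitivity allows at most one orbit of further blocks meeting A
-- and at most one of blocks disjoint from A; so both of these occur.
module Submission where

open import Level using (Level)
open import Algebra.Bundles using (Group)
import Algebra.Properties.Semiring.Sum
open import Data.Bool using (if_then_else_)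
open import Data.Fin using (Fin; zero; suc; _≟_)
open import Data.Fin.Permutation using (_⟨$⟩ʳ_)
open import Data.Fin.Properties using (any?; pigeonhole; ¬∀⟶∃¬) renaming (<⇒≢ to i<j⇒i≢j)
open import Data.Nat using (ℕ; zero; suc; _+_; _*_; _≤_; _<_; s≤s; z≤n; NonZero; >-nonZero; ≢-nonZero)
open import Data.Nat.Properties hiding (_≟_)
open import Data.Nat.Tactic.RingSolver using (solve-∀)
open import Data.Product using (_×_; ∃; ∃₂; _,_; proj₁; proj₂)
open import Data.Sum using (_⊎_; inj₁; inj₂; [_,_]′)
open import Data.Vec using (allFin; count; tabulate)
open import Function using (_∘_; id)
open import Function.Bundles using (Bijection; Equivalence; Injection; _⇔_)
open import Function.Properties.Inverse using (↔⇒↣)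
open import Relation.Binary using (DecidableEquality; Setoid)
open import Relation.Binary.PropositionalEquality
open import Relation.Nullary using (¬_; Dec; yes; no; does; contradiction)
open import Relation.Nullary.Decidable using (¬?; _×-dec_; decidable-stable)
open import Relation.Unary using (Pred; Decidable)
open import Defs

open Algebra.Properties.Semiring.Sum +-*-semiring
  using (sum; sum-syntax; sum-cong-≗; ∑-comm; ∑-permute; *-distribˡ-sum; *-distribʳ-sum)

private
  variable
    a p : Level
    n : ℕ

-- Finite sums of natural numbers.

∑-const : ∀ n c → ∑[ i < n ] c ≡ n * c
∑-const zero    c = refl
∑-const (suc n) c = cong (c +_) (∑-const n c)

∑≡0⇒≡0 : (f : Fin n → ℕ) → ∑[ i < n ] f i ≡ 0 → ∀ i → f i ≡ 0
∑≡0⇒≡0 f eq zero    = m+n≡0⇒m≡0 (f zero) eq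
∑≡0⇒≡0 f eq (suc i) = ∑≡0⇒≡0 (f ∘ suc) (m+n≡0⇒n≡0 (f zero) eq) i

∑-constant-except : (w f : Fin n → ℕ) (i : Fin n) {c : ℕ} →
  (∀ j → i ≢ j → f j ≡ c) →
  ∑[ j < n ] (w j * f j) + w i * c ≡ w i * f i + (∑[ j < n ] w j) * c
∑-constant-except {suc n} w f zero {c} off = begin
  w₀ * f zero + ∑[ j < n ] (w (suc j) * f (suc j)) + w₀ * c
    ≡⟨ cong (λ s → w₀ * f zero + s + w₀ * c)
         (sum-cong-≗ λ j → cong (w (suc j) *_) (off (suc j) λ ())) ⟩
  w₀ * f zero + ∑[ j < n ] (w (suc j) * c) + w₀ * c
    ≡⟨ cong (λ s → w₀ * f zero + s + w₀ * c) (*-distribʳ-sum c (w ∘ suc)) ⟨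
  w₀ * f zero + ∑w * c + w₀ * c
    ≡⟨ regroup w₀ (f zero) ∑w c ⟩
  w₀ * f zero + (w₀ + ∑w) * c ∎
  where
  open ≡-Reasoning
  w₀ = w zero
  ∑w = ∑[ j < n ] w (suc j)
  regroup : ∀ x y z c → x * y + z * c + x * c ≡ x * y + (x + z) * c
  regroup = solve-∀
∑-constant-except {suc n} w f (suc i) {c} off = begin
  w₀ * f zero + ∑wf + wᵢ * c    ≡⟨ cong (λ y → w₀ * y + ∑wf + wᵢ * c) (off zero λ ()) ⟩
  w₀ * c + ∑wf + wᵢ * c         ≡⟨ +-assoc (w₀ * c) ∑wf (wᵢ * c) ⟩
  w₀ * c + (∑wf + wᵢ * c)       ≡⟨ cong (w₀ * c +_) (∑-constant-except (w ∘ suc) (f ∘ suc) i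
                                     λ j i≢j → off (suc j) λ { refl → i≢j refl }) ⟩
  w₀ * c + (wᵢ * fᵢ + ∑w * c)   ≡⟨ regroup w₀ c wᵢ fᵢ ∑w ⟩
  wᵢ * fᵢ + (w₀ + ∑w) * c       ∎
  where
  open ≡-Reasoning
  w₀ = w zero
  wᵢ = w (suc i)
  fᵢ = f (suc i)
  ∑w = ∑[ j < n ] w (suc j)
  ∑wf = ∑[ j < n ] (w (suc j) * f (suc j))
  regroup : ∀ x c y z s → x * c + (y * z + s * c) ≡ y * z + (x + s) * c
  regroup = solve-∀

-- Indicators of decidable properties, and counting as summation.

𝟙 : {A : Set a} → Dec A → ℕ
𝟙 A? = if does A? then 1 else 0

𝟙-yes : {A : Set a} (A? : Dec A) → A → 𝟙 A? ≡ 1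
𝟙-yes (yes _) x = refl
𝟙-yes (no ¬x) x = contradiction x ¬x

𝟙-no : {A : Set a} (A? : Dec A) → ¬ A → 𝟙 A? ≡ 0
𝟙-no (yes x) ¬x = contradiction x ¬x
𝟙-no (no _)  ¬x = refl

𝟙-cong : ∀ {b} {A : Set a} {B : Set b} (A? : Dec A) (B? : Dec B) → A ⇔ B → 𝟙 A? ≡ 𝟙 B?
𝟙-cong A? (yes y) A⇔B = 𝟙-yes A? (Equivalence.from A⇔B y)
𝟙-cong A? (no ¬y) A⇔B = 𝟙-no A? (¬y ∘ Equivalence.to A⇔B)

𝟙-× : ∀ {b} {A : Set a} {B : Set b} (A? : Dec A) (B? : Dec B) → 𝟙 (A? ×-dec B?) ≡ 𝟙 A? * 𝟙 B?
𝟙-× (yes _) (yes _) = refl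
𝟙-× (yes _) (no _)  = refl
𝟙-× (no _)  _       = refl

𝟙-idem : {A : Set a} (A? : Dec A) → 𝟙 A? * 𝟙 A? ≡ 𝟙 A?
𝟙-idem (yes _) = refl
𝟙-idem (no _)  = refl

count-tabulate : {A : Set a} {P : Pred A p} (P? : Decidable P) (f : Fin n → A) →
                 count P? (tabulate f) ≡ ∑[ i < n ] 𝟙 (P? (f i))
count-tabulate {n = zero}  P? f = refl
count-tabulate {n = suc n} P? f with P? (f zero)
... | yes _ = cong suc (count-tabulate P? (f ∘ suc))
... | no _  = count-tabulate P? (f ∘ suc)

module _ {P : Pred (Fin n) p} (P? : Decidable P) where

  count-allFin : count P? (allFin n) ≡ ∑[ i < n ] 𝟙 (P? i)
  count-allFin = count-tabulate P? id

  all⇒count≡n : (∀ i → P i) → count P? (allFin n) ≡ n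
  all⇒count≡n all = begin
    count P? (allFin n)    ≡⟨ count-allFin ⟩
    ∑[ i < n ] 𝟙 (P? i)    ≡⟨ sum-cong-≗ (λ i → 𝟙-yes (P? i) (all i)) ⟩
    ∑[ i < n ] 1           ≡⟨ ∑-const n 1 ⟩
    n * 1                  ≡⟨ *-identityʳ n ⟩
    n                      ∎
    where open ≡-Reasoning

  none⇒count≡0 : (∀ i → ¬ P i) → count P? (allFin n) ≡ 0
  none⇒count≡0 none = begin
    count P? (allFin n)    ≡⟨ count-allFin ⟩
    ∑[ i < n ] 𝟙 (P? i)    ≡⟨ sum-cong-≗ (λ i → 𝟙-no (P? i) (none i)) ⟩
    ∑[ i < n ] 0           ≡⟨ ∑-const n 0 ⟩
    n * 0                  ≡⟨ *-zeroʳ n ⟩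
    0                      ∎
    where open ≡-Reasoning

  count≡0⇒none : count P? (allFin n) ≡ 0 → ∀ i → ¬ P i
  count≡0⇒none eq i Pi =
    1+n≢0 (trans (sym (𝟙-yes (P? i) Pi)) (∑≡0⇒≡0 _ (trans (sym count-allFin) eq) i))

  count>0⇒∃ : 0 < count P? (allFin n) → ∃ P
  count>0⇒∃ pos with any? P?
  ... | yes ∃P = ∃P
  ... | no ∄P  = contradiction (none⇒count≡0 λ i Pi → ∄P (i , Pi)) (m<n⇒n≢0 pos)

  count<n⇒∃¬ : count P? (allFin n) < n → ∃ (¬_ ∘ P)
  count<n⇒∃¬ lt = ¬∀⟶∃¬ n P P? λ all → <-irrefl (all⇒count≡n all) lt

-- Pairs of numbers with equal sum and product.

-- Both `r` and `m` are roots of the polynomial with roots `k` and `l`. To stay within the natural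
-- numbers, the larger of `r` and `k` is written as the smaller plus a difference: if that is zero,
-- then `r` is `k`; if it is positive, it can be cancelled from the product equation, which gives
-- `r ≡ l`.
equal-sum-product : ∀ r m k l → r + m ≡ k + l → k * l ≡ r * m → r ≡ k ⊎ r ≡ l
equal-sum-product r m k l sum≡ prod≡ = [ k≤r⇒ , r≤k⇒ ]′ (≤-total k r)
  where
  open ≡-Reasoning
  k≤r⇒ : k ≤ r → r ≡ k ⊎ r ≡ l
  k≤r⇒ k≤r with m≤n⇒∃[o]m+o≡n k≤r
  ... | zero  , refl = inj₁ (+-identityʳ k)
  ... | suc d , refl = inj₂ (trans (cong (_+ suc d) k≡m) (sym l≡m+d))
    where
    l≡m+d : l ≡ m + suc d
    l≡m+d = +-cancelˡ-≡ k l (m + suc d) (trans (sym sum≡) (shift k (suc d) m))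
      where
      shift : ∀ k d m → k + d + m ≡ k + (m + d)
      shift = solve-∀
    k≡m : k ≡ m
    k≡m = *-cancelʳ-≡ k m (suc d) (+-cancelˡ-≡ (k * m) _ _ (begin
      k * m + k * suc d   ≡⟨ *-distribˡ-+ k m (suc d) ⟨
      k * (m + suc d)     ≡⟨ cong (k *_) l≡m+d ⟨
      k * l               ≡⟨ prod≡ ⟩
      (k + suc d) * m     ≡⟨ expand k (suc d) m ⟩
      k * m + m * suc d   ∎))
      where
      expand : ∀ k d m → (k + d) * m ≡ k * m + m * d
      expand = solve-∀
  r≤k⇒ : r ≤ k → r ≡ k ⊎ r ≡ l
  r≤k⇒ r≤k with m≤n⇒∃[o]m+o≡n r≤k
  ... | zero  , refl = inj₁ (sym (+-identityʳ r))
  ... | suc d , refl = inj₂ (sym l≡r)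
    where
    m≡d+l : m ≡ suc d + l
    m≡d+l = +-cancelˡ-≡ r m (suc d + l) (trans sum≡ (+-assoc r (suc d) l))
    l≡r : l ≡ r
    l≡r = *-cancelˡ-≡ l r (suc d) (+-cancelˡ-≡ (r * l) _ _ (begin
      r * l + suc d * l     ≡⟨ *-distribʳ-+ l r (suc d) ⟨
      (r + suc d) * l       ≡⟨ prod≡ ⟩
      r * m                 ≡⟨ cong (r *_) m≡d+l ⟩
      r * (suc d + l)       ≡⟨ expand r (suc d) l ⟩
      r * l + suc d * r     ∎))
      where
      expand : ∀ r d l → r * (d + l) ≡ r * l + d * r
      expand = solve-∀

-- Double counting with the incidence matrix.

module Counting {v b : ℕ} (D : Design v b) where
  open Design D

  private
    -- The incidence matrix of the design.
    M : Fin v → Fin b → ℕ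
    M p B = 𝟙 (p I? B)

  replication : Fin v → ℕ
  replication p = ∑[ B < b ] M p B

  blockSize-∑ : ∀ B → blockSize D B ≡ ∑[ p < v ] M p B
  blockSize-∑ B = count-allFin (_I? B)

  commonBlocks-∑ : ∀ p q → commonBlocks D p q ≡ ∑[ B < b ] (M p B * M q B)
  commonBlocks-∑ p q =
    trans (count-allFin λ B → (p I? B) ×-dec (q I? B)) (sum-cong-≗ λ B → 𝟙-× (p I? B) (q I? B))

  commonPoints-∑ : ∀ B C → commonPoints D B C ≡ ∑[ p < v ] (M p B * M p C)
  commonPoints-∑ B C =
    trans (count-allFin λ p → (p I? B) ×-dec (p I? C)) (sum-cong-≗ λ p → 𝟙-× (p I? B) (p I? C))

  commonBlocks-self : ∀ p → commonBlocks D p p ≡ replication p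
  commonBlocks-self p = trans (commonBlocks-∑ p p) (sum-cong-≗ λ B → 𝟙-idem (p I? B))

  commonPoints-self : ∀ B → commonPoints D B B ≡ blockSize D B
  commonPoints-self B =
    trans (commonPoints-∑ B B) (trans (sum-cong-≗ λ p → 𝟙-idem (p I? B)) (sym (blockSize-∑ B)))

  -- An automorphism preserves the entries of the incidence matrix, so permuting the points by it
  -- only reindexes the sum. The images appear as equations so that the output of a transitivity
  -- hypothesis fits directly.
  commonPoints-invariant : ∀ (g : Automorphism D) {B C B′ C′} → let open Automorphism g in
    onBlocks ⟨$⟩ʳ B ≡ B′ → onBlocks ⟨$⟩ʳ C ≡ C′ → commonPoints D B C ≡ commonPoints D B′ C′
  commonPoints-invariant g {B} {C} refl refl = begin
    commonPoints D B C                        ≡⟨ commonPoints-∑ B C ⟩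
    ∑[ p < v ] (M p B * M p C)                ≡⟨ sum-cong-≗ (λ p → cong₂ _*_ (M-g p B) (M-g p C)) ⟩
    ∑[ p < v ] (M (gᵖ p) gB * M (gᵖ p) gC)    ≡⟨ ∑-permute (λ p → M p gB * M p gC) onPoints ⟨
    ∑[ p < v ] (M p gB * M p gC)              ≡⟨ commonPoints-∑ gB gC ⟨
    commonPoints D gB gC                      ∎
    where
    open ≡-Reasoning
    open Automorphism g
    gᵖ = onPoints ⟨$⟩ʳ_
    gB = onBlocks ⟨$⟩ʳ B
    gC = onBlocks ⟨$⟩ʳ C
    M-g : ∀ p E → M p E ≡ M (gᵖ p) (onBlocks ⟨$⟩ʳ E)
    M-g p E = 𝟙-cong (p I? E) (gᵖ p I? (onBlocks ⟨$⟩ʳ E)) (preserves p E)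

  -- Both sides count the pairs of a point `q` and a block `C` with `q I B`, `p I C` and `q I C`.
  ∑-commonBlocks : ∀ p B → ∑[ q < v ] (M q B * commonBlocks D p q)
                         ≡ ∑[ C < b ] (M p C * commonPoints D B C)
  ∑-commonBlocks p B = begin
    ∑[ q < v ] (M q B * commonBlocks D p q)
      ≡⟨ sum-cong-≗ (λ q → trans (cong (M q B *_) (commonBlocks-∑ p q)) (*-distribˡ-sum (M q B) λ C → M p C * M q C)) ⟩
    ∑[ q < v ] ∑[ C < b ] (M q B * (M p C * M q C))
      ≡⟨ ∑-comm (λ q C → M q B * (M p C * M q C)) ⟩
    ∑[ C < b ] ∑[ q < v ] (M q B * (M p C * M q C))
      ≡⟨ sum-cong-≗ (λ C → sum-cong-≗ λ q → swap (M q B) (M p C) (M q C)) ⟩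
    ∑[ C < b ] ∑[ q < v ] (M p C * (M q B * M q C))
      ≡⟨ sum-cong-≗ (λ C → trans (cong (M p C *_) (commonPoints-∑ B C)) (*-distribˡ-sum (M p C) λ q → M q B * M q C)) ⟨
    ∑[ C < b ] (M p C * commonPoints D B C) ∎
    where
    open ≡-Reasoning
    swap : ∀ x y z → x * (y * z) ≡ y * (x * z)
    swap = solve-∀

  module _ {k lam : ℕ} (is2 : Is2Design D k lam) where
    open Is2Design is2

    -- Flags are counted by blocks and by points.
    b*k≡∑replication : b * k ≡ ∑[ p < v ] replication p
    b*k≡∑replication = begin
      b * k                          ≡⟨ ∑-const b k ⟨
      ∑[ B < b ] k                   ≡⟨ sum-cong-≗ (λ B → trans (sym (blockSize-∑ B)) (block-size B)) ⟨
      ∑[ B < b ] ∑[ p < v ] M p B    ≡⟨ ∑-comm (λ B p → M p B) ⟩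
      ∑[ p < v ] replication p       ∎
      where open ≡-Reasoning

    -- This is r(k - 1) = λ(v - 1) without subtraction. It counts the pairs of a point `q` and a
    -- block incident with both `p` and `q`, with `q` equal to `p` allowed.
    replication-equation : ∀ p → replication p * k + lam ≡ replication p + v * lam
    replication-equation p = begin
      replication p * k + lam
        ≡⟨ cong (_+ lam) (*-distribʳ-sum k (M p)) ⟩
      ∑[ B < b ] (M p B * k) + lam
        ≡⟨ cong (_+ lam) (sum-cong-≗ λ B → trans
             (cong (M p B *_) (trans (sym (block-size B)) (blockSize-∑ B))) (*-distribˡ-sum (M p B) λ q → M q B)) ⟩
      ∑[ B < b ] ∑[ q < v ] (M p B * M q B) + lam
        ≡⟨ cong (_+ lam) (∑-comm λ B q → M p B * M q B) ⟩
      ∑[ q < v ] ∑[ B < b ] (M p B * M q B) + lam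
        -- The weight 1 is inserted to match `∑-constant-except`; the exceptional index is `q` equal
        -- to `p`, where the common blocks number `replication p` instead of `lam`.
        ≡⟨ cong₂ _+_ (sum-cong-≗ λ q → trans (*-identityˡ (commonBlocks D p q)) (commonBlocks-∑ p q)) (*-identityˡ lam) ⟨
      ∑[ q < v ] (1 * commonBlocks D p q) + 1 * lam
        ≡⟨ ∑-constant-except (λ _ → 1) (commonBlocks D p) p (λ _ → balanced) ⟩
      1 * commonBlocks D p p + ∑[ q < v ] 1 * lam
        ≡⟨ cong₂ _+_ (trans (*-identityˡ (commonBlocks D p p)) (commonBlocks-self p))
             (cong (_* lam) (trans (∑-const v 1) (*-identityʳ v))) ⟩
      replication p + v * lam ∎
      where open ≡-Reasoning

    -- Since k - 1, here `k′`, is positive, it can be cancelled in r(k - 1) = λ(v - 1), which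
    -- determines r from the parameters.
    replication-constant : 1 < k → ∀ p q → replication p ≡ replication q
    replication-constant (s≤s {n = k′} 0<k′) p q =
      *-cancelʳ-≡ (replication p) (replication q) k′ ⦃ >-nonZero 0<k′ ⦄
        (+-cancelʳ-≡ lam _ _ (trans (reduced p) (sym (reduced q))))
      where
      reduced : ∀ p → replication p * k′ + lam ≡ v * lam
      reduced p = +-cancelˡ-≡ (replication p) _ _ (begin
        replication p + (replication p * k′ + lam)   ≡⟨ +-assoc (replication p) _ lam ⟨
        replication p + replication p * k′ + lam     ≡⟨ cong (_+ lam) (*-suc (replication p) k′) ⟨
        replication p * suc k′ + lam                 ≡⟨ replication-equation p ⟩
        replication p + v * lam                      ∎)
        where open ≡-Reasoning

    ∃-incident : 0 < k → ∀ B → ∃ (_I B)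
    ∃-incident 0<k B = count>0⇒∃ (_I? B) (subst (0 <_) (sym (block-size B)) 0<k)

    ∃-non-incident : k < v → ∀ B → ∃ λ p → ¬ (p I B)
    ∃-non-incident k<v B = count<n⇒∃¬ (_I? B) (subst (_< v) (sym (block-size B)) k<v)

    module _ {m : ℕ} (meet : ∀ {B C} → B ≢ C → commonPoints D B C ≡ m) where

      -- Each side of `∑-commonBlocks` is evaluated by `∑-constant-except`, with exceptional point
      -- `p` on one side and exceptional block `B` on the other. Keeping the factor `M p B` treats
      -- incident and non-incident pairs together.
      flag-equation : ∀ p B → M p B * replication p + k * lam + M p B * m
                            ≡ M p B * k + replication p * m + M p B * lam
      flag-equation p B = begin
        M p B * replication p + k * lam + M p B * m
          ≡⟨ cong₂ (λ x y → M p B * x + y * lam + M p B * m)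
               (commonBlocks-self p) (trans (sym (blockSize-∑ B)) (block-size B)) ⟨
        M p B * commonBlocks D p p + (∑[ q < v ] M q B) * lam + M p B * m
          ≡⟨ cong (_+ M p B * m) (∑-constant-except (λ q → M q B) (commonBlocks D p) p λ _ → balanced) ⟨
        ∑[ q < v ] (M q B * commonBlocks D p q) + M p B * lam + M p B * m
          ≡⟨ cong (λ t → t + M p B * lam + M p B * m) (∑-commonBlocks p B) ⟩
        T + M p B * lam + M p B * m
          ≡⟨ swap T (M p B * lam) (M p B * m) ⟩
        T + M p B * m + M p B * lam
          ≡⟨ cong (_+ M p B * lam) (∑-constant-except (M p) (commonPoints D B) B λ _ → meet) ⟩
        M p B * commonPoints D B B + replication p * m + M p B * lam
          ≡⟨ cong (λ x → M p B * x + replication p * m + M p B * lam)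
               (trans (commonPoints-self B) (block-size B)) ⟩
        M p B * k + replication p * m + M p B * lam ∎
        where
        open ≡-Reasoning
        T = ∑[ C < b ] (M p C * commonPoints D B C)
        swap : ∀ x y z → x + y + z ≡ x + z + y
        swap = solve-∀

      -- The given block supplies an incident point, as 0 < k, and a non-incident point, as k < v.
      -- The flag equation at these two points gives the sum and the product.
      constant-intersection⇒symmetric : 1 < k → k < v → Fin b → Symmetric D
      constant-intersection⇒symmetric 1<k k<v B = [ r≡k⇒b≡v , r≡lam⇒b≡v ]′
        (equal-sum-product r m k lam sum≡ prod≡)
        where
        open ≡-Reasoning
        instance
          k-nonZero : NonZero k
          k-nonZero = >-nonZero (<-trans (s≤s z≤n) 1<k)
        p₁ = ∃-incident (<-trans (s≤s z≤n) 1<k) B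
        p₀ = ∃-non-incident k<v B
        r = replication (proj₁ p₁)

        -- At the non-incident point every term with factor `M p B` vanishes.
        prod≡ : k * lam ≡ r * m
        prod≡ = begin
          k * lam                              ≡⟨ +-identityʳ (k * lam) ⟨
          k * lam + 0                          ≡⟨ subst (λ e → e * r₀ + k * lam + e * m ≡ e * k + r₀ * m + e * lam)
                                                    (𝟙-no (proj₁ p₀ I? B) (proj₂ p₀)) (flag-equation (proj₁ p₀) B) ⟩
          r₀ * m + 0                           ≡⟨ +-identityʳ (r₀ * m) ⟩
          r₀ * m                               ≡⟨ cong (_* m) (replication-constant 1<k (proj₁ p₀) (proj₁ p₁)) ⟩
          r * m                                ∎
          where r₀ = replication (proj₁ p₀)

        -- At the incident point the factor is 1, and the equal products cancel.
        sum≡ : r + m ≡ k + lam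
        sum≡ = +-cancelʳ-≡ (k * lam) (r + m) (k + lam) (begin
          r + m + k * lam                ≡⟨ collect r m (k * lam) ⟩
          1 * r + k * lam + 1 * m        ≡⟨ subst (λ e → e * r + k * lam + e * m ≡ e * k + r * m + e * lam)
                                              (𝟙-yes (proj₁ p₁ I? B) (proj₂ p₁)) (flag-equation (proj₁ p₁) B) ⟩
          1 * k + r * m + 1 * lam        ≡⟨ collect k lam (r * m) ⟨
          k + lam + r * m                ≡⟨ cong (k + lam +_) prod≡ ⟨
          k + lam + k * lam              ∎)
          where
          collect : ∀ x y z → x + y + z ≡ 1 * x + z + 1 * y
          collect = solve-∀

        b*k≡v*r : b * k ≡ v * r
        b*k≡v*r = begin
          b * k                       ≡⟨ b*k≡∑replication ⟩
          ∑[ p < v ] replication p    ≡⟨ sum-cong-≗ (λ p → replication-constant 1<k p (proj₁ p₁)) ⟩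
          ∑[ p < v ] r                ≡⟨ ∑-const v r ⟩
          v * r                       ∎

        r≡k⇒b≡v : r ≡ k → b ≡ v
        r≡k⇒b≡v r≡k = *-cancelʳ-≡ b v k (trans b*k≡v*r (cong (v *_) r≡k))

        -- With r = λ the replication equation reduces to kr = vr. As `p₁` lies on `B`, r is
        -- nonzero, so k = v, against k < v.
        r≡lam⇒b≡v : r ≡ lam → b ≡ v
        r≡lam⇒b≡v r≡lam = contradiction (*-cancelʳ-≡ k v r k*r≡v*r) (<⇒≢ k<v)
          where
          instance
            r-nonZero : NonZero r
            r-nonZero = ≢-nonZero λ r≡0 →
              1+n≢0 (trans (sym (𝟙-yes (proj₁ p₁ I? B) (proj₂ p₁))) (∑≡0⇒≡0 _ r≡0 B))
          k*r≡v*r : k * r ≡ v * r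
          k*r≡v*r = +-cancelˡ-≡ r (k * r) (v * r) (begin
            r + k * r      ≡⟨ +-comm r (k * r) ⟩
            k * r + r      ≡⟨ cong₂ _+_ (*-comm k r) r≡lam ⟩
            r * k + lam    ≡⟨ replication-equation (proj₁ p₁) ⟩
            r + v * lam    ≡⟨ cong (λ x → r + v * x) r≡lam ⟨
            r + v * r      ∎)

-- Orbits of a point stabiliser.

module _ {c ℓ} {G : Group c ℓ} (H : Subgroup G p) {X : Set a} (α : Action G X) (x₀ : X) where

  private
    _~_ = SameOrbit (Stabiliser H α x₀) α

  fixed-orbit : ∀ {x} → x₀ ~ x → x₀ ≡ x
  fixed-orbit (_ , (_ , gx₀≡x₀) , gx₀≡x) = trans (sym gx₀≡x₀) gx₀≡x

  -- The orbit of `x₀` is a singleton, so the orbit indices of `x` and `y` both differ from that of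
  -- `x₀`; in `Fin 2` only one index is left.
  two-orbits : HasOrbits (Stabiliser H α x₀) α 2 → ∀ {x y} → x₀ ≢ x → x₀ ≢ y → x ~ y
  two-orbits orbits {x} {y} x₀≢x x₀≢y =
    transˢ (symˢ (rep x)) (transˢ (reflexiveˢ (cong to (third (index x₀) (index x) (index y)
      (differs x₀≢x) (differs x₀≢y)))) (rep y))
    where
    open Bijection orbits using (to; strictlySurjective)
    open Setoid (Orbits (Stabiliser H α x₀) α) using ()
      renaming (sym to symˢ; trans to transˢ; reflexive to reflexiveˢ)
    index : X → Fin 2
    index z = proj₁ (strictlySurjective z)
    rep : ∀ z → to (index z) ~ z
    rep z = proj₂ (strictlySurjective z)
    differs : ∀ {z} → x₀ ≢ z → index x₀ ≢ index z
    differs {z} x₀≢z eq =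
      x₀≢z (fixed-orbit (transˢ (symˢ (rep x₀)) (transˢ (reflexiveˢ (cong to eq)) (rep z))))
    third : ∀ (i j k : Fin 2) → i ≢ j → i ≢ k → j ≡ k
    third zero       zero       _          i≢j _   = contradiction refl i≢j
    third zero       (suc zero) zero       _   i≢k = contradiction refl i≢k
    third zero       (suc zero) (suc zero) _   _   = refl
    third (suc zero) zero       zero       _   _   = refl
    third (suc zero) zero       (suc zero) _   i≢k = contradiction refl i≢k
    third (suc zero) (suc zero) _          i≢j _   = contradiction refl i≢j

  -- It suffices to search the three orbit representatives. If each were `x₀` or in `E`, the
  -- pigeonhole principle would give two of them both equal to `x₀` or both in `E` and different
  -- from `x₀`, hence in the same orbit.
  third-orbit : DecidableEquality X → ∀ {e} {E : Pred X e} → Decidable E →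
    HasOrbits (Stabiliser H α x₀) α 3 →
    (∀ {x y} → x₀ ≢ x → x₀ ≢ y → E x → E y → x ~ y) → ∃ λ x → x₀ ≢ x × ¬ E x
  third-orbit _≟ˣ_ {E = E} E? orbits E-orbit
    with any? (λ i → ¬? (x₀ ≟ˣ to i) ×-dec ¬? (E? (to i)))
    where open Bijection orbits using (to)
  ... | yes (i , x₀≢x , ¬Ex) = Bijection.to orbits i , x₀≢x , ¬Ex
  ... | no ∄ = let _ , _ , i<j , same-colour = pigeonhole (n<1+n 2) (λ i → colour (x₀ ≟ˣ to i))
               in contradiction (injective (same same-colour)) (i<j⇒i≢j i<j)
    where
    open Bijection orbits using (to; injective)
    colour : ∀ {x} → Dec (x₀ ≡ x) → Fin 2
    colour (yes _) = zero
    colour (no _)  = suc zero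
    inE : ∀ i → x₀ ≢ to i → E (to i)
    inE i x₀≢x = decidable-stable (E? (to i)) λ ¬Ex → ∄ (i , x₀≢x , ¬Ex)
    same : ∀ {i j} → colour (x₀ ≟ˣ to i) ≡ colour (x₀ ≟ˣ to j) → to i ~ to j
    same {i} {j} eq with x₀ ≟ˣ to i | x₀ ≟ˣ to j
    ... | yes p | yes q = reflexiveˢ (trans (sym p) q)
      where
      open Setoid (Orbits (Stabiliser H α x₀) α) using () renaming (reflexive to reflexiveˢ)
    ... | no p  | no q  = E-orbit p q (inE i p) (inE j q)

-- Designs of rank 2 and rank 3 on blocks.

module _ {v b : ℕ} (D : Design v b) {ℓ : Level} (G : Subgroup (Aut D) ℓ) (pt : PairwiseTransitive D G) where
  open Design D
  open Counting D
  open PairwiseTransitive pt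

  intersecting? : ∀ B C → Dec (Intersecting D B C)
  intersecting? B C = any? λ p → (p I? B) ×-dec (p I? C)

  rank2⇒symmetric : ∀ {k lam} → Is2Design D k lam → NonTrivial v k → HasRank G (blockAction D) 2 → Symmetric D
  rank2⇒symmetric is2 (2<k , k<v) (transitive , A , orbits) =
    constant-intersection⇒symmetric is2 meet (<-trans (s≤s (s≤s z≤n)) 2<k) k<v A
    where
    open Bijection orbits using (to; injective)
    open Setoid (Orbits (Stabiliser G (blockAction D) A) (blockAction D)) using ()
      renaming (reflexive to reflexiveˢ)
    -- Representatives of different orbits are distinct blocks; their intersection size serves as
    -- the constant m.
    X Y : Fin b
    X = to zero
    Y = to (suc zero)
    X≢Y : X ≢ Y
    X≢Y X≡Y = contradiction (injective (reflexiveˢ X≡Y)) λ ()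
    -- The orbits are those of the stabiliser of `A`, so transitivity is used first to move the pair
    -- to one starting with `A`.
    moved-to-A : ∀ {B C} → B ≢ C → ∃ λ E → A ≢ E × commonPoints D B C ≡ commonPoints D A E
    moved-to-A {B} {C} B≢C with transitive B A
    ... | g , _ , gB≡A = onBlocks ⟨$⟩ʳ C
        , (λ A≡gC → B≢C (Injection.injective (↔⇒↣ onBlocks) (trans gB≡A A≡gC)))
        , commonPoints-invariant g gB≡A refl
      where
      open Automorphism g
    meet : ∀ {B C} → B ≢ C → commonPoints D B C ≡ commonPoints D X Y
    meet B≢C with moved-to-A B≢C | moved-to-A X≢Y
    ... | E , A≢E , BC | F , A≢F , XY with two-orbits G (blockAction D) A orbits A≢E A≢F
    ... | g , (_ , gA≡A) , gE≡F = trans BC (trans (commonPoints-invariant g gA≡A gE≡F) (sym XY))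

  rank3⇒quasisymmetric : HasRank G (blockAction D) 3 →
    Quasisymmetric D × ∃₂ λ (B C : Fin b) → B ≢ C × Disjoint D B C
  rank3⇒quasisymmetric (_ , A , orbits)
    -- The first application yields a block disjoint from `A`; the second, with the complementary
    -- property, yields a block other than `A` that meets it.
    with third-orbit G (blockAction D) A _≟_ (intersecting? A) orbits
           (λ {B} {C} A≢B A≢C AB AC → stabilising (intersecting-blocks (A , B) (A , C) (A≢B , AB) (A≢C , AC)))
       | third-orbit G (blockAction D) A _≟_ (λ B → ¬? (intersecting? A B)) orbits
           (λ {B} {C} _ _ AB AC → stabilising (disjoint-blocks (A , B) (A , C) AB AC))
    where
    -- An element carrying one pair to another with the same first block `A` fixes `A`.
    stabilising : ∀ {B C} → SameOrbit G (pairAction (blockAction D) (blockAction D)) (A , B) (A , C) →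
                  SameOrbit (Stabiliser G (blockAction D) A) (blockAction D) B C
    stabilising (g , g∈G , eq) = g , (g∈G , cong proj₁ eq) , cong proj₂ eq
  ... | B , A≢B , AB-disjoint | C , A≢C , ¬AC-disjoint =
    ( commonPoints D A C , 0 , m≢0 , values
    , (A , C , A≢C , refl) , (A , B , A≢B , disjoint⇒0 AB-disjoint))
    , A , B , A≢B , AB-disjoint
    where
    AC-intersecting : Intersecting D A C
    AC-intersecting = decidable-stable (intersecting? A C) ¬AC-disjoint
    disjoint⇒0 : ∀ {E F} → Disjoint D E F → commonPoints D E F ≡ 0
    disjoint⇒0 {E} {F} dis = none⇒count≡0 (λ p → (p I? E) ×-dec (p I? F)) λ p pEF → dis (p , pEF)
    m≢0 : commonPoints D A C ≢ 0
    m≢0 eq = count≡0⇒none (λ p → (p I? A) ×-dec (p I? C)) eq (proj₁ AC-intersecting) (proj₂ AC-intersecting)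
    -- All pairs of distinct intersecting blocks form one orbit, so they share the intersection
    -- number of `A` and `C`.
    values : ∀ {E F} → E ≢ F → commonPoints D E F ≡ commonPoints D A C ⊎ commonPoints D E F ≡ 0
    values {E} {F} E≢F with intersecting? E F
    ... | no dis = inj₂ (disjoint⇒0 dis)
    ... | yes EF with intersecting-blocks (E , F) (A , C) (E≢F , EF) (A≢C , AC-intersecting)
    ... | g , _ , eq = inj₁ (commonPoints-invariant g (cong proj₁ eq) (cong proj₂ eq))

lemma2p4 : ∀ {ℓ : Level} {v b k lam : ℕ} (D : Design v b) → Is2Design D k lam → NonTrivial v k →
    (G : Subgroup (Aut D) ℓ) → PairwiseTransitive D G →
    (HasRank G (blockAction D) 2 → Symmetric D) ×
    (HasRank G (blockAction D) 3 → Quasisymmetric D × ∃₂ λ (B C : Fin b) → B ≢ C × Disjoint D B C)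
lemma2p4 D is2 nonTrivial G pt = rank2⇒symmetric D G pt is2 nonTrivial , rank3⇒quasisymmetric D G pt
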